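{- Let $d,k \in \mathbf{N}$ with $d \geq 2k + 6$ and let $\alpha \in (0,1)$. There exist $q_0 = q_0(\alpha,k)$ and $c = c(\alpha,k) > 0$ such that the following holds for every odd prime power $q \geq q_0$: if $A \subseteq \mathbf{F}_q^d$ satisfies $|A| \geq \alpha q^d$, then for every $(k+2)$-point spherical configuration $X \subseteq \mathbf{F}_q^d$ spanning $k$ dimensions, $A$ contains at least $c\, q^{(k + 1)d - k(k + 1)/2}$ isometric copies of $X$.
   Context: $\mathbf{F}_q$ is a finite field of odd characteristic. For $v,w\in\mathbf{F}_q^d$, $v\cdot w=\sum_{j=1}^d v_jw_j$ and $|v|^2 := v\cdot v$ (an $\mathbf{F}_q$-valued "length"; $|v-w|^2$ is the "distance"). For $u\in\mathbf{F}_q^d$ and $\lambda\in\mathbf{F}_q$, the sphere is $S_\lambda(u)=\{x\in\mathbf{F}_q^d : |x-u|^2=\lambda\}$. A finite set $X\subseteq\mathbf{F}_q^d$ spans $k$ dimensions if $\dim \operatorname{Span}(X-X)=k$, and is spherical if $X\subseteq S_\lambda(u)$ for some $u\in\mathbf{F}_q^d$, $\lambda\in\mathbf{F}_q$. Two sets $X,X'$ are isometric if there is a bijection $\phi:X\to X'$ with $|\phi(x)-\phi(x')|^2=|x-x'|^2$ for all $x,x'\in X$; an isometric copy of $X$ in $A$ is a subset of $A$ isometric to $X$. -}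

module Defs where

open import Level using (0ℓ)
open import Data.Nat as ℕ using (ℕ; zero; suc)
open import Data.Nat.DivMod using (_/_)
open import Data.Integer using (+_)
open import Data.Rational as ℚ using (ℚ)
open import Data.Fin using (Fin)
open import Data.Vec using (Vec; zipWith; map; replicate)
open import Data.Vec.Functional using () renaming (foldr to foldrF)
open import Data.List using (List; length)
open import Data.List.Membership.Propositional using (_∈_)
open import Data.List.Relation.Unary.Unique.Propositional using (Unique)
open import Data.Product using (Σ; ∃; _×_; _,_)
open import Function.Definitions using (Injective)
open import Relation.Binary.PropositionalEquality using (_≡_; _≢_)
open import Algebra.Structures using (IsCommutativeRing)

record FiniteField : Set₁ where
  field
    Carrier  : Set
    _+_ _*_  : Carrier → Carrier → Carrier
    -_       : Carrier → Carrier
    0# 1#    : Carrier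
    isCommutativeRing : IsCommutativeRing _≡_ _+_ _*_ -_ 0# 1#
    0≢1      : 0# ≢ 1#
    inverse  : ∀ x → x ≢ 0# → ∃ λ y → x * y ≡ 1#
    elements : List Carrier
    unique   : Unique elements
    complete : ∀ x → x ∈ elements

  size : ℕ
  size = length elements

  OddCharacteristic : Set
  OddCharacteristic = (1# + 1#) ≢ 0#

  Point : ℕ → Set
  Point d = Vec Carrier d

  _⊕_ : ∀ {d} → Point d → Point d → Point d
  _⊕_ = zipWith _+_

  _⊖_ : ∀ {d} → Point d → Point d → Point d
  v ⊖ w = zipWith _+_ v (map -_ w)

  _·_ : ∀ {d} → Carrier → Point d → Point d
  a · v = map (a *_) v

  𝟎 : ∀ {d} → Point d
  𝟎 = replicate _ 0#

  dot : ∀ {d} → Point d → Point d → Carrier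
  dot v w = Data.Vec.foldr _ _+_ 0# (zipWith _*_ v w)

  ∣_∣² : ∀ {d} → Point d → Carrier
  ∣ v ∣² = dot v v

  lincomb : ∀ {d m} → (Fin m → Carrier) → (Fin m → Point d) → Point d
  lincomb {m = m} a b = foldrF _⊕_ 𝟎 (λ j → a j · b j)

  InSpan : ∀ {d m} → Point d → (Fin m → Point d) → Set
  InSpan v b = ∃ λ a → v ≡ lincomb a b

  LinearlyIndependent : ∀ {d m} → (Fin m → Point d) → Set
  LinearlyIndependent b = ∀ a → lincomb a b ≡ 𝟎 → ∀ j → a j ≡ 0#

  SpanDim : ∀ {d} {I : Set} → (I → Point d) → ℕ → Set
  SpanDim {d} {I} S k =
    Σ (Fin k → Point d) λ b →
      LinearlyIndependent b
      × (∀ i → InSpan (S i) b)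
      × (∀ j → ∃ λ (n : ℕ) → ∃ λ (a : Fin n → Carrier) → ∃ λ (idx : Fin n → I) →
             b j ≡ lincomb a (λ t → S (idx t)))

  SpansDim : ∀ {d m} → (Fin m → Point d) → ℕ → Set
  SpansDim {m = m} x k = SpanDim (λ (p : Fin m × Fin m) → x (Data.Product.proj₁ p) ⊖ x (Data.Product.proj₂ p)) k

  Spherical : ∀ {d m} → (Fin m → Point d) → Set
  Spherical {d} x = ∃ λ (u : Point d) → ∃ λ (lam : Carrier) → ∀ i → ∣ x i ⊖ u ∣² ≡ lam

  -- An isometric copy of X = {x_i} in A, presented as y_i = φ(x_i) where
  -- φ : X → Y is the isometric bijection: y injective, y_i ∈ A,
  -- |y_i − y_j|² = |x_i − x_j|².
  IsometricCopyIn : ∀ {d m} → List (Point d) → (Fin m → Point d) → (Fin m → Point d) → Set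
  IsometricCopyIn A x y =
    Injective _≡_ _≡_ y × (∀ i → y i ∈ A) × (∀ i j → ∣ y i ⊖ y j ∣² ≡ ∣ x i ⊖ x j ∣²)

  DifferentSets : ∀ {d m} → (Fin m → Point d) → (Fin m → Point d) → Set
  DifferentSets y z = ∃ λ i → ∀ j → y i ≢ z j

  AtLeastCopies : ∀ {d m} → ℕ → List (Point d) → (Fin m → Point d) → Set
  AtLeastCopies {d} {m} N A x =
    Σ (Fin N → Fin m → Point d) λ Y →
      (∀ n → IsometricCopyIn A x (Y n))
      × (∀ n n′ → n ≢ n′ → DifferentSets (Y n) (Y n′))

ℕ→ℚ : ℕ → ℚ
ℕ→ℚ n = (+ n) ℚ./ 1

exponent : ℕ → ℕ → ℕ
exponent k d = (suc k ℕ.* d) ℕ.∸ ((k ℕ.* suc k) / 2)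

{-# OPTIONS --safe #-}
-- Write f_s(v) for the number of b ∈ B with |v − b|² = s. Distinct points b, b′ are equidistant from
-- at most q^(d−1) points v, so the sum of (q f_s(v) − |B|)² over all pairs (v, s) is at most
-- |B| q^(d+2); discarding all s but one by positivity, only O(q^(d+2)/|B|) points v have
-- f_s(v) < |B|/2q. No exponential sum is needed.
-- Cut A into k+2 disjoint parts of equal size and choose y_0, y_1, … from successive parts,
-- keeping for every later index the candidates at the right distances from the points chosen so
-- far. Each step divides the candidate sets by at most 2q and, as d ≥ 2k + 6, leaves at least half
-- of the possible choices usable. So y_i has ≫ q^(d−i) choices for i ≤ k; one choice of y_(k+1)
-- suffices, and the product is q^((k+1)d − k(k+1)/2). As the parts are disjoint, the points y_i
-- are distinct and different tuples give different sets.
module Submission where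

open import Defs
open import Data.Nat as ℕ using (ℕ; zero; suc; _+_; _*_; _^_; _∸_; _≥_; _≤_; z≤n; s≤s)
open import Data.Nat.DivMod using (_/_; _%_; m≡m%n+[m/n]*n; m%n<n; m/n≤m; m*n/n≡m; m/n*n≤m)
import Data.Nat.Properties as ℕₚ
open import Data.Nat.Tactic.RingSolver as ℕ-Ring using ()
import Data.Integer as ℤ
import Data.Integer.Properties as ℤₚ
open import Data.Rational as ℚ using (ℚ; mkℚ)
import Data.Rational.Properties as ℚₚ
import Data.Rational.Unnormalised as ℚᵘ
import Data.Rational.Unnormalised.Properties as ℚᵘₚ
open import Data.Fin as Fin using (Fin; zero; suc)
import Data.Fin.Properties as Finₚ
open import Data.Vec using ([]; _∷_)
import Data.Vec.Properties as Vecₚ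
import Data.Vec.Functional as Vector
open import Data.List as List using (List; []; _∷_; _++_; length; map; filter; take; drop; lookup)
import Data.List.Properties as Listₚ
open import Data.List.Membership.Propositional using (_∈_)
open import Data.List.Membership.Propositional.Properties
  using (∈-cartesianProductWith⁺; ∈-filter⁻; ∈-lookup; ∈-length)
open import Data.List.Relation.Binary.Subset.Propositional using (_⊆_)
open import Data.List.Relation.Unary.All as All using (All; []; _∷_)
import Data.List.Relation.Unary.All.Properties as Allₚ
open import Data.List.Relation.Unary.AllPairs as AllPairs using (AllPairs; []; _∷_)
import Data.List.Relation.Unary.AllPairs.Properties as AllPairsₚ
open import Data.List.Relation.Unary.Any as Any using (here; there)
import Data.List.Relation.Unary.Any.Properties as Anyₚ
open import Data.List.Relation.Unary.Unique.Propositional using (Unique)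
import Data.List.Relation.Unary.Unique.Propositional.Properties as Uniqueₚ
open import Data.Product using (Σ; ∃; _×_; _,_; proj₁; proj₂)
open import Data.Sum using (inj₁; inj₂)
open import Function using (_∘_)
open import Function.Definitions using (Injective)
open import Algebra.Bundles using (CommutativeRing)
import Algebra.Properties.Group as GroupProperties
import Algebra.Properties.Ring as RingProperties
import Algebra.Solver.Ring.NaturalCoefficients.Default as SemiringSolver
open import Level using (0ℓ)
open import Relation.Binary using (tri<; tri≈; tri>; DecidableEquality)
open import Relation.Binary.PropositionalEquality
  using (_≡_; _≢_; refl; sym; trans; cong; cong₂; subst; module ≡-Reasoning)
open import Relation.Nullary using (¬_; Dec; yes; no; ¬?; contradiction)
open import Relation.Unary using (Decidable)

-- Indicators and finite sums of natural numbers.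

⟦_⟧ : {P : Set} → Dec P → ℕ
⟦ yes _ ⟧ = 1
⟦ no  _ ⟧ = 0

⟦⟧-mono : {P Q : Set} (P? : Dec P) (Q? : Dec Q) → (P → Q) → ⟦ P? ⟧ ≤ ⟦ Q? ⟧
⟦⟧-mono (yes p) (yes q) f = ℕₚ.≤-refl
⟦⟧-mono (yes p) (no ¬q) f = contradiction (f p) ¬q
⟦⟧-mono (no ¬p) Q?      f = z≤n

⟦⟧-true : {P : Set} (P? : Dec P) → P → 1 ≤ ⟦ P? ⟧
⟦⟧-true (yes _) _ = ℕₚ.≤-refl
⟦⟧-true (no ¬p) p = contradiction p ¬p

⟦⟧≤1 : {P : Set} (P? : Dec P) → ⟦ P? ⟧ ≤ 1
⟦⟧≤1 (yes _) = ℕₚ.≤-refl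
⟦⟧≤1 (no _)  = z≤n

module _ {A : Set} where

  ∑ : List A → (A → ℕ) → ℕ
  ∑ []       f = 0
  ∑ (x ∷ xs) f = f x + ∑ xs f

  ∑-mono : ∀ xs {f g : A → ℕ} → (∀ x → f x ≤ g x) → ∑ xs f ≤ ∑ xs g
  ∑-mono []       f≤g = z≤n
  ∑-mono (x ∷ xs) f≤g = ℕₚ.+-mono-≤ (f≤g x) (∑-mono xs f≤g)

  ∑-cong : ∀ xs {f g : A → ℕ} → (∀ x → f x ≡ g x) → ∑ xs f ≡ ∑ xs g
  ∑-cong []       f≡g = refl
  ∑-cong (x ∷ xs) f≡g = cong₂ _+_ (f≡g x) (∑-cong xs f≡g)

  ∑-const : ∀ xs c → ∑ xs (λ _ → c) ≡ length xs * c
  ∑-const []       c = refl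
  ∑-const (x ∷ xs) c = cong (_+_ c) (∑-const xs c)

  ∑-+ : ∀ xs (f g : A → ℕ) → ∑ xs (λ x → f x + g x) ≡ ∑ xs f + ∑ xs g
  ∑-+ []       f g = refl
  ∑-+ (x ∷ xs) f g = trans (cong (_+_ (f x + g x)) (∑-+ xs f g)) (interchange (f x) (g x) _ _)
    where
    interchange : ∀ a b c d → (a + b) + (c + d) ≡ (a + c) + (b + d)
    interchange = ℕ-Ring.solve-∀

  ∑-*ˡ : ∀ c xs (f : A → ℕ) → ∑ xs (λ x → c * f x) ≡ c * ∑ xs f
  ∑-*ˡ c []       f = sym (ℕₚ.*-zeroʳ c)
  ∑-*ˡ c (x ∷ xs) f = trans (cong (_+_ (c * f x)) (∑-*ˡ c xs f)) (sym (ℕₚ.*-distribˡ-+ c (f x) _))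

  ∑-++ : ∀ xs ys (f : A → ℕ) → ∑ (xs ++ ys) f ≡ ∑ xs f + ∑ ys f
  ∑-++ []       ys f = refl
  ∑-++ (x ∷ xs) ys f = trans (cong (_+_ (f x)) (∑-++ xs ys f)) (sym (ℕₚ.+-assoc (f x) _ _))

  ∑-∈ : ∀ {x xs} (f : A → ℕ) → x ∈ xs → f x ≤ ∑ xs f
  ∑-∈ f (here refl) = ℕₚ.m≤m+n _ _
  ∑-∈ f (there x∈)  = ℕₚ.≤-trans (∑-∈ f x∈) (ℕₚ.m≤n+m _ _)

  -- This is how a sum over all distances keeps the extra gain `e` at one distance while the other
  -- terms are merely compared.
  ∑-mono-gap : ∀ {x xs} {f g : A → ℕ} {e} → x ∈ xs → f x + e ≤ g x → (∀ y → f y ≤ g y) →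
               ∑ xs f + e ≤ ∑ xs g
  ∑-mono-gap {xs = x ∷ xs} {f} {g} {e} (here refl) gap f≤g = ℕₚ.≤-trans
    (ℕₚ.≤-reflexive (rotate (f x) (∑ xs f) e)) (ℕₚ.+-mono-≤ gap (∑-mono xs f≤g))
    where
    rotate : ∀ a b c → a + b + c ≡ a + c + b
    rotate = ℕ-Ring.solve-∀
  ∑-mono-gap {xs = y ∷ xs} {f} (there x∈) gap f≤g = ℕₚ.≤-trans
    (ℕₚ.≤-reflexive (ℕₚ.+-assoc (f y) _ _)) (ℕₚ.+-mono-≤ (f≤g y) (∑-mono-gap x∈ gap f≤g))

  ∑-atMostOne : ∀ {xs} {P : A → Set} (P? : ∀ x → Dec (P x)) → Unique xs →
                (∀ {x y} → P x → P y → x ≡ y) → ∑ xs (λ x → ⟦ P? x ⟧) ≤ 1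
  ∑-atMostOne P? [] same = z≤n
  ∑-atMostOne {x ∷ xs} {P} P? (x∉xs ∷ xs!) same with P? x
  ... | no _  = ∑-atMostOne P? xs! same
  ... | yes p = s≤s (ℕₚ.≤-reflexive (none xs x∉xs))
    where
    none : ∀ ys → All (x ≢_) ys → ∑ ys (λ y → ⟦ P? y ⟧) ≡ 0
    none []       []           = refl
    none (y ∷ ys) (x≢y ∷ x≢ys) with P? y
    ... | yes p′ = contradiction (same p p′) x≢y
    ... | no _   = none ys x≢ys

  length≤∑ : ∀ {P : A → Set} (P? : ∀ x → Dec (P x)) xs → All P xs →
             length xs ≤ ∑ xs (λ x → ⟦ P? x ⟧)
  length≤∑ P? []       []         = z≤n
  length≤∑ P? (x ∷ xs) (px ∷ pxs) = ℕₚ.+-mono-≤ (⟦⟧-true (P? x) px) (length≤∑ P? xs pxs)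

  length-filter-∑ : ∀ {P : A → Set} (P? : Decidable P) xs →
                    length (filter P? xs) ≡ ∑ xs (λ x → ⟦ P? x ⟧)
  length-filter-∑ P? [] = refl
  length-filter-∑ P? (x ∷ xs) with P? x
  ... | yes _ = cong suc (length-filter-∑ P? xs)
  ... | no _  = length-filter-∑ P? xs

  length-filter-split : ∀ {P : A → Set} (P? : Decidable P) xs →
    length xs ≡ length (filter P? xs) + length (filter (¬? ∘ P?) xs)
  length-filter-split P? [] = refl
  length-filter-split P? (x ∷ xs) with P? x
  ... | yes _ = cong suc (length-filter-split P? xs)
  ... | no _  = trans (cong suc (length-filter-split P? xs)) (sym (ℕₚ.+-suc _ _))

  -- Filter by the predicates one after another: the entries rejected at one stage form a list
  -- without repetitions that violates one predicate, so each stage loses at most `t`.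
  union-bound : ∀ m {P : Fin m → A → Set} (P? : ∀ j → Decidable (P j)) {t} →
    (∀ j ys → Unique ys → All (λ y → ¬ P j y) ys → length ys ≤ t) →
    ∀ xs → Unique xs →
    ∃ λ ys → Unique ys × ys ⊆ xs × (∀ j → All (P j) ys) × length xs ≤ length ys + m * t
  union-bound zero P? few xs xs! =
    xs , xs! , (λ x∈ → x∈) , (λ ()) , ℕₚ.≤-reflexive (sym (ℕₚ.+-identityʳ _))
  union-bound (suc m) {P} P? {t} few xs xs! =
    let xs′ = filter (P? zero) xs
        ys , ys! , ys⊆xs′ , good , bound =
          union-bound m (P? ∘ suc) (few ∘ suc) xs′ (Uniqueₚ.filter⁺ (P? zero) xs!)
        xs′⊆xs : xs′ ⊆ xs
        xs′⊆xs = proj₁ ∘ ∈-filter⁻ (P? zero)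
        good₀ : All (P zero) ys
        good₀ = All.tabulate (proj₂ ∘ ∈-filter⁻ (P? zero) {xs = xs} ∘ ys⊆xs′)
        few₀ = few zero _ (Uniqueₚ.filter⁺ (¬? ∘ P? zero) xs!) (Allₚ.all-filter (¬? ∘ P? zero) xs)
    in ys , ys! , xs′⊆xs ∘ ys⊆xs′ , (λ { zero → good₀ ; (suc j) → good j }) ,
       ℕₚ.≤-trans (ℕₚ.≤-reflexive (length-filter-split (P? zero) xs))
         (ℕₚ.≤-trans (ℕₚ.+-mono-≤ bound few₀) (ℕₚ.≤-reflexive (regroup (length ys) (m * t) t)))
    where
    regroup : ∀ a b c → a + b + c ≡ a + (c + b)
    regroup = ℕ-Ring.solve-∀

∑-swap : {A B : Set} → ∀ xs ys (f : A → B → ℕ) →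
         ∑ xs (λ x → ∑ ys (f x)) ≡ ∑ ys (λ y → ∑ xs (λ x → f x y))
∑-swap []       ys f = sym (trans (∑-const ys 0) (ℕₚ.*-zeroʳ (length ys)))
∑-swap (x ∷ xs) ys f =
  trans (cong (_+_ (∑ ys (f x))) (∑-swap xs ys f)) (sym (∑-+ ys (f x) _))

∑-map : {A B : Set} (g : A → B) → ∀ xs (f : B → ℕ) → ∑ (map g xs) f ≡ ∑ xs (f ∘ g)
∑-map g []       f = refl
∑-map g (x ∷ xs) f = cong (_+_ (f (g x))) (∑-map g xs f)

∑-cartesianProductWith : {A B C : Set} (g : A → B → C) → ∀ xs ys (f : C → ℕ) →
  ∑ (List.cartesianProductWith g xs ys) f ≡ ∑ xs (λ x → ∑ ys (λ y → f (g x y)))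
∑-cartesianProductWith g []       ys f = refl
∑-cartesianProductWith g (x ∷ xs) ys f = trans (∑-++ (map (g x) ys) _ f)
  (cong₂ _+_ (∑-map (g x) ys f) (∑-cartesianProductWith g xs ys f))

∑-square : {A : Set} → ∀ xs (f : A → ℕ) → ∑ xs f * ∑ xs f ≡ ∑ xs (λ x → ∑ xs (λ y → f x * f y))
∑-square xs f = trans (ℕₚ.*-comm (∑ xs f) (∑ xs f)) (trans (sym (∑-*ˡ (∑ xs f) xs f))
  (∑-cong xs (λ x → trans (ℕₚ.*-comm (∑ xs f) (f x)) (sym (∑-*ˡ (f x) xs f)))))

-- Sum against the diagonal: h x ≤ ∑_{y ∈ ys} [x ≡ y] h y, then exchange the two sums.
∑-⊆ : {A : Set} (_≟_ : DecidableEquality A) {xs ys : List A} (h : A → ℕ) →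
      Unique xs → xs ⊆ ys → ∑ xs h ≤ ∑ ys h
∑-⊆ {A} _≟_ {xs} {ys} h xs! xs⊆ys = begin
  ∑ xs h                                               ≤⟨ diagonal xs xs⊆ys ⟩
  ∑ xs (λ x → ∑ ys (λ y → h y * ⟦ x ≟ y ⟧))            ≡⟨ ∑-swap xs ys _ ⟩
  ∑ ys (λ y → ∑ xs (λ x → h y * ⟦ x ≟ y ⟧))            ≡⟨ ∑-cong ys (λ y → ∑-*ˡ (h y) xs _) ⟩
  ∑ ys (λ y → h y * ∑ xs (λ x → ⟦ x ≟ y ⟧))            ≤⟨ ∑-mono ys (λ y → ℕₚ.*-monoʳ-≤ (h y)
      (∑-atMostOne (_≟ y) xs! (λ p q → trans p (sym q)))) ⟩
  ∑ ys (λ y → h y * 1)                                 ≡⟨ ∑-cong ys (λ y → ℕₚ.*-identityʳ (h y)) ⟩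
  ∑ ys h                                               ∎
  where
  open ℕₚ.≤-Reasoning
  hit : ∀ x → h x ≤ h x * ⟦ x ≟ x ⟧
  hit x with x ≟ x
  ... | yes _  = ℕₚ.≤-reflexive (sym (ℕₚ.*-identityʳ (h x)))
  ... | no x≢x = contradiction refl x≢x
  diagonal : ∀ zs → zs ⊆ ys → ∑ zs h ≤ ∑ zs (λ x → ∑ ys (λ y → h y * ⟦ x ≟ y ⟧))
  diagonal []       _  = z≤n
  diagonal (z ∷ zs) ⊆ys = ℕₚ.+-mono-≤
    (ℕₚ.≤-trans (hit z) (∑-∈ (λ y → h y * ⟦ z ≟ y ⟧) (⊆ys (here refl))))
    (diagonal zs (⊆ys ∘ there))

-- Families of distinct tuples and the constants of the greedy choice.

-- Tuples are functions, so an explicit index of disagreement is carried; once the coordinates are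
-- confined to disjoint sets it yields `DifferentSets`.
Distinct : {V : Set} {n : ℕ} → (Fin n → V) → (Fin n → V) → Set
Distinct y z = ∃ λ i → y i ≢ z i

-- Stands for having at least a/b tuples, with the denominator cleared so that the counting stays in
-- ℕ.
Family : {V : Set} {n : ℕ} → ((Fin n → V) → Set) → ℕ → ℕ → Set
Family {V} {n} P a b =
  Σ (List (Fin n → V)) λ Ys → a ≤ length Ys * b × All P Ys × AllPairs Distinct Ys

-- Tuples with the same head differ because their tails do, tuples with different heads because `G`
-- has no repetitions; so the families over all heads can be concatenated and their lengths add.
extend-family : {V : Set} {n : ℕ} {P : V → (Fin n → V) → Set} {a b : ℕ} → ∀ G → Unique G →
  (∀ {v} → v ∈ G → Family (P v) a b) →
  Family (λ y → y zero ∈ G × P (y zero) (y ∘ suc)) (length G * a) b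
extend-family []      []          _        = [] , z≤n , [] , []
extend-family {V} {n} {a = a} {b} (v ∷ G) (v∉G ∷ G!) families
  with Zs , a≤ , PZs , Zs! ← families (here refl)
     | Ys , Ga≤ , PYs , Ys! ← extend-family G G! (families ∘ there) =
  map (v Vector.∷_) Zs ++ Ys
  , (begin
      a + length G * a                           ≤⟨ ℕₚ.+-mono-≤ a≤ Ga≤ ⟩
      length Zs * b + length Ys * b              ≡⟨ ℕₚ.*-distribʳ-+ b (length Zs) (length Ys) ⟨
      (length Zs + length Ys) * b                ≡⟨ cong (λ l → (l + length Ys) * b) (Listₚ.length-map _ Zs) ⟨
      (length (map (v Vector.∷_) Zs) + length Ys) * b
                                                 ≡⟨ cong (_* b) (Listₚ.length-++ (map (v Vector.∷_) Zs)) ⟨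
      length (map (v Vector.∷_) Zs ++ Ys) * b    ∎)
  , Allₚ.++⁺ (Allₚ.map⁺ (All.map (here refl ,_) PZs))
      (All.map (λ (y₀∈G , p) → there y₀∈G , p) PYs)
  , AllPairsₚ.++⁺ (AllPairsₚ.map⁺ (AllPairs.map (λ (j , ≢) → suc j , ≢) Zs!)) Ys!
      (Allₚ.map⁺ (All.universal (λ _ → All.map (λ (y₀∈G , _) → zero , All.lookup v∉G y₀∈G) PYs) Zs))
  where open ℕₚ.≤-Reasoning

-- For m points still to be chosen freely, when each candidate set has at least q^(d−i)/D elements:
-- q^(md) / (loss m D · q^(codim m i)) tuples are found as soon as q ≥ threshold m D.
loss : ℕ → ℕ → ℕ
loss zero    D = 1
loss (suc m) D = 2 * D * loss m (2 * D)

codim : ℕ → ℕ → ℕ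
codim zero    i = 0
codim (suc m) i = i + codim m (suc i)

-- `codim (suc m) i` is the arithmetic progression i + (i+1) + ... + (i+m); doubling avoids a
-- division.
codim-closed : ∀ m i → codim (suc m) i * 2 ≡ suc m * (2 * i + m)
codim-closed zero    i = base i
  where
  base : ∀ i → (i + 0) * 2 ≡ 1 * (2 * i + 0)
  base = ℕ-Ring.solve-∀
codim-closed (suc m) i = begin
  (i + codim (suc m) (suc i)) * 2              ≡⟨ ℕₚ.*-distribʳ-+ 2 i _ ⟩
  i * 2 + codim (suc m) (suc i) * 2            ≡⟨ cong (i * 2 +_) (codim-closed m (suc i)) ⟩
  i * 2 + suc m * (2 * suc i + m)              ≡⟨ regroup i m ⟩
  suc (suc m) * (2 * i + suc m)                ∎
  where
  open ≡-Reasoning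
  regroup : ∀ i m → i * 2 + suc m * (2 * suc i + m) ≡ suc (suc m) * (2 * i + suc m)
  regroup = ℕ-Ring.solve-∀

-- One step asks for q at least `m * (8 * (D * D))`. Each choice doubles `D` and so quadruples
-- `D * D`; the factor `4 ^ m` pays in advance for the later steps.
threshold : ℕ → ℕ → ℕ
threshold m D = m * (8 * (D * D)) * 4 ^ m

threshold-step : ∀ m D → threshold m (2 * D) ≤ threshold (suc m) D
threshold-step m D = ℕₚ.≤-trans (ℕₚ.≤-reflexive (regroup m D (4 ^ m)))
  (ℕₚ.*-monoˡ-≤ (4 ^ suc m) (ℕₚ.*-monoˡ-≤ (8 * (D * D)) (ℕₚ.n≤1+n m)))
  where
  regroup : ∀ m D x → m * (8 * ((2 * D) * (2 * D))) * x ≡ m * (8 * (D * D)) * (4 * x)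
  regroup = ℕ-Ring.solve-∀

-- Positions in lists and disjoint blocks.

AllPairs-lookup : {A : Set} {R : A → A → Set} → (∀ {x y} → R x y → R y x) → ∀ {xs} → AllPairs R xs →
                  ∀ i j → i ≢ j → R (lookup xs i) (lookup xs j)
AllPairs-lookup R-sym (Rx ∷ Rxs) zero    zero    i≢j = contradiction refl i≢j
AllPairs-lookup R-sym (Rx ∷ Rxs) zero    (suc j) i≢j = All.lookup Rx (∈-lookup j)
AllPairs-lookup R-sym (Rx ∷ Rxs) (suc i) zero    i≢j = R-sym (All.lookup Rx (∈-lookup i))
AllPairs-lookup R-sym (Rx ∷ Rxs) (suc i) (suc j) i≢j = AllPairs-lookup R-sym Rxs i j (i≢j ∘ cong suc)

inhabitant : {A : Set} (xs : List A) → xs ≢ [] → ∃ λ x → x ∈ xs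
inhabitant []      []≢[] = contradiction refl []≢[]
inhabitant (x ∷ _) _     = x , here refl

take-⊆ : {A : Set} → ∀ s (xs : List A) → take s xs ⊆ xs
take-⊆ s xs = All.lookup (Allₚ.take⁺ s (All.tabulate λ x∈ → x∈))

drop-⊆ : {A : Set} → ∀ s (xs : List A) → drop s xs ⊆ xs
drop-⊆ s xs = All.lookup (Allₚ.drop⁺ s (All.tabulate λ x∈ → x∈))

take-drop-disjoint : {A : Set} → ∀ s {xs : List A} → Unique xs → ∀ {x} → x ∈ take s xs → ¬ x ∈ drop s xs
take-drop-disjoint (suc s) {_ ∷ xs} (x∉xs ∷ xs!) (here refl) x∈ = All.lookup x∉xs (drop-⊆ s xs x∈) refl
take-drop-disjoint (suc s) {_ ∷ xs} (x∉xs ∷ xs!) (there x∈t) x∈ = take-drop-disjoint s xs! x∈t x∈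

split-disjoint : {A : Set} → ∀ n s (xs : List A) → Unique xs → n * s ≤ length xs →
  ∃ λ (B : Fin n → List A) → (∀ j → Unique (B j)) × (∀ j → s ≤ length (B j)) × (∀ j → B j ⊆ xs) ×
    (∀ i j {x} → x ∈ B i → x ∈ B j → i ≡ j)
split-disjoint zero    s xs xs! _  = (λ ()) , (λ ()) , (λ ()) , (λ ()) , λ ()
split-disjoint (suc n) s xs xs! ns≤
  with B , B! , s≤B , B⊆ , disjoint ← split-disjoint n s (drop s xs) (Uniqueₚ.drop⁺ s xs!)
         (ℕₚ.≤-trans (ℕₚ.m+n≤o⇒m≤o∸n (n * s) (ℕₚ.≤-trans (ℕₚ.≤-reflexive (ℕₚ.+-comm (n * s) s)) ns≤))
           (ℕₚ.≤-reflexive (sym (Listₚ.length-drop s xs)))) =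
  take s xs Vector.∷ B
  , (λ { zero → Uniqueₚ.take⁺ s xs! ; (suc j) → B! j })
  , (λ { zero    → ℕₚ.≤-reflexive (sym (trans (Listₚ.length-take s xs) (ℕₚ.m≤n⇒m⊓n≡m (ℕₚ.m+n≤o⇒m≤o s ns≤))))
       ; (suc j) → s≤B j })
  , (λ { zero → take-⊆ s xs ; (suc j) → drop-⊆ s xs ∘ B⊆ j })
  , λ { zero    zero    _   _   → refl
      ; zero    (suc j) x∈t x∈B → contradiction (B⊆ j x∈B) (take-drop-disjoint s xs! x∈t)
      ; (suc i) zero    x∈B x∈t → contradiction (B⊆ i x∈B) (take-drop-disjoint s xs! x∈t)
      ; (suc i) (suc j) x∈i x∈j → cong suc (disjoint i j x∈i x∈j) }

-- Quadratic inequalities in the natural numbers.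

private
  -- 4(a − N)² is nonnegative, and at least N² if 2a ≤ N, with the cross term moved to the left.
  am-gm : ∀ N a → 8 * N * a ≤ 4 * (a * a + N * N)
  am-gm N a with ℕₚ.≤-total a N
  ... | inj₁ a≤N with e , refl ← ℕₚ.m≤n⇒∃[o]m+o≡n a≤N =
    ℕₚ.m+n≤o⇒m≤o _ (ℕₚ.≤-reflexive (identity a e))
    where
    identity : ∀ a e → 8 * (a + e) * a + 4 * (e * e) ≡ 4 * (a * a + (a + e) * (a + e))
    identity = ℕ-Ring.solve-∀
  ... | inj₂ N≤a with e , refl ← ℕₚ.m≤n⇒∃[o]m+o≡n N≤a =
    ℕₚ.m+n≤o⇒m≤o _ (ℕₚ.≤-reflexive (identity N e))
    where
    identity : ∀ N e → 8 * N * (N + e) + 4 * (e * e) ≡ 4 * ((N + e) * (N + e) + N * N)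
    identity = ℕ-Ring.solve-∀

  am-gm-gap : ∀ N a → 2 * a ≤ N → 8 * N * a + N * N ≤ 4 * (a * a + N * N)
  am-gm-gap N a 2a≤N with e , refl ← ℕₚ.m≤n⇒∃[o]m+o≡n 2a≤N =
    ℕₚ.m+n≤o⇒m≤o _ (ℕₚ.≤-reflexive (identity a e))
    where
    identity : ∀ a e → 8 * (2 * a + e) * a + (2 * a + e) * (2 * a + e) + (4 * (a * e) + 3 * (e * e))
                     ≡ 4 * (a * a + (2 * a + e) * (2 * a + e))
    identity = ℕ-Ring.solve-∀

-- Distances and points over a finite field.

module FieldGeometry (F : FiniteField) where

  open FiniteField F public renaming
    (_+_ to infixl 6 _+ᶠ_; _*_ to infixl 7 _*ᶠ_; -_ to infix 8 -ᶠ_; size to q)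

  commutativeRing : CommutativeRing 0ℓ 0ℓ
  commutativeRing = record { isCommutativeRing = isCommutativeRing }

  module R = CommutativeRing commutativeRing
  open GroupProperties R.+-group
    using (x∙y⁻¹≈ε⇒x≈y; ⁻¹-anti-homo-//; ⁻¹-involutive; \\-leftDividesʳ)
    renaming (∙-cancelˡ to +-cancelˡ; ∙-cancelʳ to +-cancelʳ)
  open RingProperties R.ring using (-‿distribˡ-*; -‿distribʳ-*)

  -- `complete` gives each element a position in `elements`, and looking that position up recovers
  -- the element; so comparing positions decides equality.
  _≟_ : DecidableEquality Carrier
  x ≟ y with Any.index (complete x) Finₚ.≟ Any.index (complete y)
  ... | yes i≡j = yes (trans (Anyₚ.lookup-index (complete x))
                    (trans (cong (lookup elements) i≡j) (sym (Anyₚ.lookup-index (complete y)))))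
  ... | no i≢j  = no λ { refl → i≢j refl }

  _≟ᵖ_ : ∀ {d} → DecidableEquality (Point d)
  _≟ᵖ_ = Vecₚ.≡-dec _≟_

  instance
    q-nonZero : ℕ.NonZero q
    q-nonZero = ℕ.>-nonZero (∈-length (complete 0#))

  *-cancelˡ : ∀ {x y z} → x ≢ 0# → x *ᶠ y ≡ x *ᶠ z → y ≡ z
  *-cancelˡ {x} {y} {z} x≢0 xy≡xz with x⁻¹ , xx⁻¹≡1 ← inverse x x≢0 =
    trans (sym (undo y)) (trans (cong (x⁻¹ *ᶠ_) xy≡xz) (undo z))
    where
    undo : ∀ w → x⁻¹ *ᶠ (x *ᶠ w) ≡ w
    undo w = begin
      x⁻¹ *ᶠ (x *ᶠ w)    ≡⟨ R.*-assoc x⁻¹ x w ⟨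
      (x⁻¹ *ᶠ x) *ᶠ w    ≡⟨ cong (_*ᶠ w) (R.*-comm x⁻¹ x) ⟩
      (x *ᶠ x⁻¹) *ᶠ w    ≡⟨ cong (_*ᶠ w) xx⁻¹≡1 ⟩
      1# *ᶠ w            ≡⟨ R.*-identityˡ w ⟩
      w                  ∎
      where open ≡-Reasoning

  sq : Carrier → Carrier
  sq x = x *ᶠ x

  dist : ∀ {d} → Point d → Point d → Carrier
  dist v w = ∣ v ⊖ w ∣²

  sq-neg : ∀ x → sq (-ᶠ x) ≡ sq x
  sq-neg x = begin
    -ᶠ x *ᶠ -ᶠ x       ≡⟨ -‿distribˡ-* x (-ᶠ x) ⟨
    -ᶠ (x *ᶠ -ᶠ x)     ≡⟨ cong -ᶠ_ (-‿distribʳ-* x x) ⟨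
    -ᶠ (-ᶠ (x *ᶠ x))   ≡⟨ ⁻¹-involutive (x *ᶠ x) ⟩
    x *ᶠ x             ∎
    where open ≡-Reasoning

  dist-sym : ∀ {d} (v w : Point d) → dist v w ≡ dist w v
  dist-sym []      []      = refl
  dist-sym (x ∷ v) (y ∷ w) = cong₂ _+ᶠ_
    (trans (cong sq (sym (⁻¹-anti-homo-// y x))) (sq-neg (y +ᶠ -ᶠ x))) (dist-sym v w)

  dist-refl : ∀ {d} (v : Point d) → dist v v ≡ 0#
  dist-refl []      = refl
  dist-refl (x ∷ v) = begin
    sq (x +ᶠ -ᶠ x) +ᶠ dist v v  ≡⟨ cong₂ _+ᶠ_ (cong sq (R.-‿inverseʳ x)) (dist-refl v) ⟩
    sq 0# +ᶠ 0#                   ≡⟨ R.+-identityʳ _ ⟩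
    sq 0#                         ≡⟨ R.zeroˡ 0# ⟩
    0#                            ∎
    where open ≡-Reasoning

  points : ∀ d → List (Point d)
  points zero    = [] ∷ []
  points (suc d) = List.cartesianProductWith _∷_ elements (points d)

  points-complete : ∀ {d} (v : Point d) → v ∈ points d
  points-complete []      = here refl
  points-complete (x ∷ v) = ∈-cartesianProductWith⁺ _∷_ (complete x) (points-complete v)

  ∑-points-const : ∀ d c → ∑ (points d) (λ _ → c) ≡ q ^ d * c
  ∑-points-const zero    c = refl
  ∑-points-const (suc d) c = begin
    ∑ (points (suc d)) (λ _ → c)              ≡⟨ ∑-cartesianProductWith _∷_ elements (points d) _ ⟩
    ∑ elements (λ _ → ∑ (points d) λ _ → c)   ≡⟨ ∑-const elements _ ⟩
    q * ∑ (points d) (λ _ → c)                ≡⟨ cong (q *_) (∑-points-const d c) ⟩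
    q * (q ^ d * c)                           ≡⟨ ℕₚ.*-assoc q (q ^ d) c ⟨
    q ^ suc d * c                             ∎
    where open ≡-Reasoning

  -- Bisectors in odd characteristic.

  module _ (odd : OddCharacteristic) where

    private
      double-injective : ∀ {x y} → x +ᶠ x ≡ y +ᶠ y → x ≡ y
      double-injective {x} {y} eq = *-cancelˡ odd (trans (expand x) (trans eq (sym (expand y))))
        where
        expand : ∀ z → (1# +ᶠ 1#) *ᶠ z ≡ z +ᶠ z
        expand z = trans (R.distribʳ z 1# 1#) (cong₂ _+ᶠ_ (R.*-identityˡ z) (R.*-identityˡ z))

      -- Exchanging `a` and `c` changes the first bracket on the right only in its order, so
      -- comparing the two expansions leaves 2bc against 2ba. Without subtraction the identity is
      -- within reach of a semiring solver.
      cross-expansion : ∀ a b c s t →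
        (sq a +ᶠ s) +ᶠ (sq (c +ᶠ b) +ᶠ t) ≡
        (sq a +ᶠ sq b +ᶠ sq c +ᶠ s +ᶠ t) +ᶠ (b *ᶠ c +ᶠ b *ᶠ c)
      cross-expansion = solve 5 (λ a b c s t →
        (a :* a :+ s) :+ ((c :+ b) :* (c :+ b) :+ t) :=
        (a :* a :+ b :* b :+ c :* c :+ s :+ t) :+ (b :* c :+ b :* c)) refl
        where open SemiringSolver R.commutativeSemiring

      -- (a + b)² − a² is affine in a with slope 2b.
      square-difference-injective′ : ∀ {a b c s t} → b ≢ 0# →
        sq a +ᶠ s ≡ sq (a +ᶠ b) +ᶠ t → sq c +ᶠ s ≡ sq (c +ᶠ b) +ᶠ t → c ≡ a
      square-difference-injective′ {a} {b} {c} {s} {t} b≢0 eqa eqc =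
        *-cancelˡ b≢0 (double-injective (+-cancelˡ (sq a +ᶠ sq b +ᶠ sq c +ᶠ s +ᶠ t) _ _ (begin
          (sq a +ᶠ sq b +ᶠ sq c +ᶠ s +ᶠ t) +ᶠ (b *ᶠ c +ᶠ b *ᶠ c)
            ≡⟨ cross-expansion a b c s t ⟨
          (sq a +ᶠ s) +ᶠ (sq (c +ᶠ b) +ᶠ t)
            ≡⟨ cong₂ _+ᶠ_ eqa (sym eqc) ⟩
          (sq (a +ᶠ b) +ᶠ t) +ᶠ (sq c +ᶠ s)
            ≡⟨ R.+-comm _ _ ⟩
          (sq c +ᶠ s) +ᶠ (sq (a +ᶠ b) +ᶠ t)
            ≡⟨ cross-expansion c b a s t ⟩
          (sq c +ᶠ sq b +ᶠ sq a +ᶠ s +ᶠ t) +ᶠ (b *ᶠ a +ᶠ b *ᶠ a)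
            ≡⟨ cong (λ z → z +ᶠ s +ᶠ t +ᶠ (b *ᶠ a +ᶠ b *ᶠ a)) (reverse (sq c) (sq b) (sq a)) ⟩
          (sq a +ᶠ sq b +ᶠ sq c +ᶠ s +ᶠ t) +ᶠ (b *ᶠ a +ᶠ b *ᶠ a)
            ∎)))
        where
        open ≡-Reasoning
        reverse : ∀ x y z → x +ᶠ y +ᶠ z ≡ z +ᶠ y +ᶠ x
        reverse x y z = trans (R.+-comm (x +ᶠ y) z) (trans (cong (z +ᶠ_) (R.+-comm x y)) (sym (R.+-assoc z y x)))

    -- With a = u - x and b = x - y one has u - y = a + b, which reduces this to the affine case
    -- above. For equidistance it means that, once the other coordinates are fixed, at most one
    -- value of this coordinate remains.
    square-difference-injective : ∀ {x y s t v w} → x ≢ y →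
      sq (v +ᶠ -ᶠ x) +ᶠ s ≡ sq (v +ᶠ -ᶠ y) +ᶠ t →
      sq (w +ᶠ -ᶠ x) +ᶠ s ≡ sq (w +ᶠ -ᶠ y) +ᶠ t → v ≡ w
    square-difference-injective {x} {y} {s} {t} {v} {w} x≢y eqv eqw =
      +-cancelʳ (-ᶠ x) v w (square-difference-injective′ (x≢y ∘ x∙y⁻¹≈ε⇒x≈y x y)
        (shift w eqw) (shift v eqv))
      where
      shift : ∀ u → sq (u +ᶠ -ᶠ x) +ᶠ s ≡ sq (u +ᶠ -ᶠ y) +ᶠ t →
              sq (u +ᶠ -ᶠ x) +ᶠ s ≡ sq ((u +ᶠ -ᶠ x) +ᶠ (x +ᶠ -ᶠ y)) +ᶠ t
      shift u eq = trans eq (cong (λ z → sq z +ᶠ t) (sym (trans (R.+-assoc u (-ᶠ x) _)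
        (cong (u +ᶠ_) (\\-leftDividesʳ x (-ᶠ y))))))

    equidistant : ∀ {d} (b b′ : Point d) → ℕ
    equidistant {d} b b′ = ∑ (points d) (λ v → ⟦ dist v b ≟ dist v b′ ⟧)

    -- Induction on the dimension. Equal first coordinates cancel and leave the bisector of `b` and
    -- `b′` once for each of the q values of `u`. If they differ, each choice of the remaining
    -- coordinates admits at most one `u`.
    q*equidistant≤q^d : ∀ {d} (b b′ : Point d) → b ≢ b′ → q * equidistant b b′ ≤ q ^ d
    q*equidistant≤q^d []      []        b≢b′ = contradiction refl b≢b′
    q*equidistant≤q^d {suc d} (x ∷ b) (y ∷ b′) b≢b′ with x ≟ y
    ... | yes refl = ℕₚ.*-monoʳ-≤ q (begin
      equidistant (x ∷ b) (x ∷ b′)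
        ≡⟨ ∑-cartesianProductWith _∷_ elements (points d) _ ⟩
      ∑ elements (λ u → ∑ (points d) (λ v → ⟦ dist (u ∷ v) (x ∷ b) ≟ dist (u ∷ v) (x ∷ b′) ⟧))
        ≤⟨ ∑-mono elements (λ u → ∑-mono (points d) (λ v →
             ⟦⟧-mono (_ ≟ _) (_ ≟ _) (+-cancelˡ (sq (u +ᶠ -ᶠ x)) (dist v b) (dist v b′)))) ⟩
      ∑ elements (λ _ → equidistant b b′)
        ≡⟨ ∑-const elements _ ⟩
      q * equidistant b b′
        ≤⟨ q*equidistant≤q^d b b′ (b≢b′ ∘ cong (x ∷_)) ⟩
      q ^ d ∎)
      where
      open ℕₚ.≤-Reasoning
    ... | no x≢y = ℕₚ.*-monoʳ-≤ q (begin
      equidistant (x ∷ b) (y ∷ b′)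
        ≡⟨ ∑-cartesianProductWith _∷_ elements (points d) _ ⟩
      ∑ elements (λ u → ∑ (points d) (λ v → ⟦ dist (u ∷ v) (x ∷ b) ≟ dist (u ∷ v) (y ∷ b′) ⟧))
        ≡⟨ ∑-swap elements (points d) _ ⟩
      ∑ (points d) (λ v → ∑ elements (λ u → ⟦ dist (u ∷ v) (x ∷ b) ≟ dist (u ∷ v) (y ∷ b′) ⟧))
        ≤⟨ ∑-mono (points d) (λ v → ∑-atMostOne _ unique (square-difference-injective x≢y)) ⟩
      ∑ (points d) (λ _ → 1)
        ≡⟨ trans (∑-points-const d 1) (ℕₚ.*-identityʳ _) ⟩
      q ^ d ∎)
      where open ℕₚ.≤-Reasoning

    -- First and second moments of the degrees.

    -- This is the f_s(v) of the opening idea.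
    degree : ∀ {d} → Carrier → Point d → List (Point d) → ℕ
    degree s v B = ∑ B (λ b → ⟦ dist v b ≟ s ⟧)

    length≤∑-degree : ∀ {d} (v : Point d) B → length B ≤ ∑ elements (λ s → degree s v B)
    length≤∑-degree v B = begin
      length B                                                ≡⟨ trans (∑-const B 1) (ℕₚ.*-identityʳ _) ⟨
      ∑ B (λ _ → 1)                                           ≤⟨ ∑-mono B (λ b →
        ℕₚ.≤-trans (⟦⟧-true (dist v b ≟ dist v b) refl)
          (∑-∈ (λ s → ⟦ dist v b ≟ s ⟧) (complete (dist v b)))) ⟩
      ∑ B (λ b → ∑ elements (λ s → ⟦ dist v b ≟ s ⟧))         ≡⟨ ∑-swap B elements _ ⟩
      ∑ elements (λ s → degree s v B)                         ∎
      where open ℕₚ.≤-Reasoning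

    ∑-coincidences : ∀ x y → ∑ elements (λ s → ⟦ x ≟ s ⟧ * ⟦ y ≟ s ⟧) ≤ ⟦ x ≟ y ⟧
    ∑-coincidences x y with x ≟ y
    ... | yes refl = ℕₚ.≤-trans (∑-mono elements (λ s → idempotent (x ≟ s)))
                       (∑-atMostOne (x ≟_) unique (λ p r → trans (sym p) r))
      where
      idempotent : {P : Set} (P? : Dec P) → ⟦ P? ⟧ * ⟦ P? ⟧ ≤ ⟦ P? ⟧
      idempotent (yes _) = ℕₚ.≤-refl
      idempotent (no _)  = z≤n
    ... | no x≢y = ℕₚ.≤-trans (∑-mono elements (λ s → exclusive (x ≟ s) (y ≟ s)))
                     (ℕₚ.≤-reflexive (trans (∑-const elements 0) (ℕₚ.*-zeroʳ q)))
      where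
      exclusive : ∀ {s} (p? : Dec (x ≡ s)) (r? : Dec (y ≡ s)) → ⟦ p? ⟧ * ⟦ r? ⟧ ≤ 0
      exclusive (yes p) (yes r) = contradiction (trans p (sym r)) x≢y
      exclusive (yes p) (no _)  = z≤n
      exclusive (no _)  r?      = z≤n

    -- Expanding the squares gives pairs (b, b′). A pair counts for `s` only if both distances from
    -- `v` equal `s`, hence for at most one `s`, and only if `v` is equidistant from the pair.
    ∑-degree² : ∀ {d} (v : Point d) B → ∑ elements (λ s → degree s v B * degree s v B) ≤
                ∑ B (λ b → ∑ B (λ b′ → ⟦ dist v b ≟ dist v b′ ⟧))
    ∑-degree² v B = begin
      ∑ elements (λ s → degree s v B * degree s v B)
        ≡⟨ ∑-cong elements (λ s → ∑-square B _) ⟩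
      ∑ elements (λ s → ∑ B (λ b → ∑ B (λ b′ → ⟦ dist v b ≟ s ⟧ * ⟦ dist v b′ ≟ s ⟧)))
        ≡⟨ ∑-swap elements B _ ⟩
      ∑ B (λ b → ∑ elements (λ s → ∑ B (λ b′ → ⟦ dist v b ≟ s ⟧ * ⟦ dist v b′ ≟ s ⟧)))
        ≡⟨ ∑-cong B (λ b → ∑-swap elements B _) ⟩
      ∑ B (λ b → ∑ B (λ b′ → ∑ elements (λ s → ⟦ dist v b ≟ s ⟧ * ⟦ dist v b′ ≟ s ⟧)))
        ≤⟨ ∑-mono B (λ b → ∑-mono B (λ b′ → ∑-coincidences (dist v b) (dist v b′))) ⟩
      ∑ B (λ b → ∑ B (λ b′ → ⟦ dist v b ≟ dist v b′ ⟧)) ∎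
      where open ℕₚ.≤-Reasoning

    energy : ∀ {d} → List (Point d) → ℕ
    energy {d} B = ∑ (points d) (λ v → ∑ elements (λ s → degree s v B * degree s v B))

    -- After exchanging the sums, each of the |B| diagonal pairs contributes at most q^d points and
    -- every other pair at most q^(d-1).
    q*energy≤ : ∀ {d} (B : List (Point d)) → Unique B →
                q * energy B ≤ length B * (q * q ^ d + length B * q ^ d)
    q*energy≤ {d} B B! = begin
      q * energy B
        ≤⟨ ℕₚ.*-monoʳ-≤ q (∑-mono (points d) (λ v → ∑-degree² v B)) ⟩
      q * ∑ (points d) (λ v → ∑ B (λ b → ∑ B (λ b′ → ⟦ dist v b ≟ dist v b′ ⟧)))
        ≡⟨ cong (q *_) (trans (∑-swap (points d) B _) (∑-cong B (λ b → ∑-swap (points d) B _))) ⟩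
      q * ∑ B (λ b → ∑ B (λ b′ → equidistant b b′))
        ≡⟨ trans (∑-cong B (λ b → ∑-*ˡ q B _)) (∑-*ˡ q B _) ⟨
      ∑ B (λ b → ∑ B (λ b′ → q * equidistant b b′))
        ≤⟨ ∑-mono B (λ b → ∑-mono B (λ b′ → pointwise b b′)) ⟩
      ∑ B (λ b → ∑ B (λ b′ → q * q ^ d * ⟦ b′ ≟ᵖ b ⟧ + q ^ d))
        ≡⟨ ∑-cong B (λ b → trans (∑-+ B _ _) (cong₂ _+_ (∑-*ˡ (q * q ^ d) B _) (∑-const B (q ^ d)))) ⟩
      ∑ B (λ b → q * q ^ d * ∑ B (λ b′ → ⟦ b′ ≟ᵖ b ⟧) + length B * q ^ d)
        ≤⟨ ∑-mono B (λ b → ℕₚ.+-monoˡ-≤ _ (ℕₚ.≤-trans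
             (ℕₚ.*-monoʳ-≤ (q * q ^ d) (∑-atMostOne (_≟ᵖ b) B! (λ p r → trans p (sym r))))
             (ℕₚ.≤-reflexive (ℕₚ.*-identityʳ _)))) ⟩
      ∑ B (λ _ → q * q ^ d + length B * q ^ d)
        ≡⟨ ∑-const B _ ⟩
      length B * (q * q ^ d + length B * q ^ d) ∎
      where
      open ℕₚ.≤-Reasoning
      pointwise : ∀ b b′ → q * equidistant b b′ ≤ q * q ^ d * ⟦ b′ ≟ᵖ b ⟧ + q ^ d
      pointwise b b′ with b′ ≟ᵖ b
      ... | no b′≢b = ℕₚ.≤-trans (q*equidistant≤q^d b b′ (b′≢b ∘ sym)) (ℕₚ.m≤n+m _ _)
      ... | yes _   = ℕₚ.≤-trans (ℕₚ.*-monoʳ-≤ q (ℕₚ.≤-trans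
                        (∑-mono (points d) (λ v → ⟦⟧≤1 (dist v b ≟ dist v b′)))
                        (ℕₚ.≤-reflexive (trans (∑-points-const d 1) (ℕₚ.*-identityʳ _)))))
                        (ℕₚ.≤-trans (ℕₚ.≤-reflexive (sym (ℕₚ.*-identityʳ _))) (ℕₚ.m≤m+n _ _))

    -- Points with few neighbours at a given distance.

    -- The cut-off |B|/2q is half the average of the degree over all distances.
    Rich : ∀ {d} → Carrier → List (Point d) → Point d → Set
    Rich s B v = length B ≤ 2 * (q * degree s v B)

    rich? : ∀ {d} s (B : List (Point d)) → Decidable (Rich s B)
    rich? s B v = length B ℕ.≤? 2 * (q * degree s v B)

    -- The variance of q · degree about |B|, taken over all pairs (v, s), is at most |B| q^(d+2);
    -- each v that is not rich for s contributes at least |B|²/4 to it.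
    few-poor : ∀ {d} s (B : List (Point d)) → Unique B → ∀ C → Unique C →
               All (λ v → ¬ Rich s B v) C → length C * length B ≤ 4 * q ^ (2 + d)
    few-poor {d} s B B! C C! poor = cancel N bound
      where
      open ℕₚ.≤-Reasoning
      N = length B
      Q = q ^ d
      a : Point d → Carrier → ℕ
      a v t = q * degree t v B
      β : Point d → ℕ
      β v = ⟦ ¬? (rich? s B v) ⟧
      M = ∑ (points d) β

      length-C≤M : length C ≤ M
      length-C≤M = ℕₚ.≤-trans (length≤∑ (λ v → ¬? (rich? s B v)) C poor)
        (∑-⊆ _≟ᵖ_ β C! (λ {v} _ → points-complete v))

      -- The right side is four times the sum of (a v t - N)² with the cross term moved over; the
      -- degrees of `v` sum to at least N, so that term is at least 8N · qN.
      local : ∀ v → 8 * N * (q * N) + N * N * β v ≤ ∑ elements (λ t → 4 * (a v t * a v t + N * N))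
      local v = begin
        8 * N * (q * N) + N * N * β v
          ≤⟨ ℕₚ.+-monoˡ-≤ _ (ℕₚ.*-monoʳ-≤ (8 * N) (ℕₚ.*-monoʳ-≤ q (length≤∑-degree v B))) ⟩
        8 * N * (q * ∑ elements (λ t → degree t v B)) + N * N * β v
          ≡⟨ cong (_+ N * N * β v) (trans (∑-*ˡ (8 * N) elements _) (cong (8 * N *_) (∑-*ˡ q elements _))) ⟨
        ∑ elements (λ t → 8 * N * a v t) + N * N * β v
          ≤⟨ ∑-mono-gap (complete s) (gap (rich? s B v)) (λ t → am-gm N (a v t)) ⟩
        ∑ elements (λ t → 4 * (a v t * a v t + N * N)) ∎
        where
        gap : ∀ r? → 8 * N * a v s + N * N * ⟦ ¬? r? ⟧ ≤ 4 * (a v s * a v s + N * N)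
        gap (yes _) = ℕₚ.≤-trans (ℕₚ.≤-reflexive
          (trans (cong (8 * N * a v s +_) (ℕₚ.*-zeroʳ (N * N))) (ℕₚ.+-identityʳ _))) (am-gm N (a v s))
        gap (no ¬rich) = ℕₚ.≤-trans (ℕₚ.≤-reflexive
          (cong (8 * N * a v s +_) (ℕₚ.*-identityʳ (N * N))))
          (am-gm-gap N (a v s) (ℕₚ.<⇒≤ (ℕₚ.≰⇒> ¬rich)))

      square-sum : ∀ v → ∑ elements (λ t → 4 * (a v t * a v t + N * N)) ≡
                   4 * (q * q * ∑ elements (λ t → degree t v B * degree t v B) + q * (N * N))
      square-sum v = trans (∑-*ˡ 4 elements _) (cong (4 *_) (trans (∑-+ elements _ _)
        (cong₂ _+_ (trans (∑-cong elements (λ t → regroup q (degree t v B))) (∑-*ˡ (q * q) elements _))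
                   (∑-const elements (N * N)))))
        where
        regroup : ∀ x y → (x * y) * (x * y) ≡ x * x * (y * y)
        regroup = ℕ-Ring.solve-∀

      global : Q * (8 * N * (q * N)) + N * N * M ≤ 4 * (q * q * energy B + Q * (q * (N * N)))
      global = begin
        Q * (8 * N * (q * N)) + N * N * M
          ≡⟨ trans (∑-+ (points d) _ _) (cong₂ _+_ (∑-points-const d _) (∑-*ˡ (N * N) (points d) β)) ⟨
        ∑ (points d) (λ v → 8 * N * (q * N) + N * N * β v)
          ≤⟨ ∑-mono (points d) local ⟩
        ∑ (points d) (λ v → ∑ elements (λ t → 4 * (a v t * a v t + N * N)))
          ≡⟨ trans (∑-cong (points d) square-sum) (∑-*ˡ 4 (points d) _) ⟩
        4 * ∑ (points d) (λ v → q * q * ∑ elements (λ t → degree t v B * degree t v B) + q * (N * N))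
          ≡⟨ cong (4 *_) (trans (∑-+ (points d) _ _)
               (cong₂ _+_ (∑-*ˡ (q * q) (points d) _) (∑-points-const d _))) ⟩
        4 * (q * q * energy B + Q * (q * (N * N))) ∎

      -- Two terms 4N²qQ, one from the pairs in the energy and one from the constant N², cancel the
      -- 8N²qQ on the left exactly. Only the diagonal contribution survives.
      bound : N * N * M ≤ N * (4 * (q * (q * Q)))
      bound = ℕₚ.+-cancelˡ-≤ (Q * (8 * N * (q * N))) _ _ (begin
        Q * (8 * N * (q * N)) + N * N * M
          ≤⟨ global ⟩
        4 * (q * q * energy B + Q * (q * (N * N)))
          ≡⟨ cong (λ x → 4 * (x + Q * (q * (N * N)))) (ℕₚ.*-assoc q q (energy B)) ⟩
        4 * (q * (q * energy B) + Q * (q * (N * N)))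
          ≤⟨ ℕₚ.*-monoʳ-≤ 4 (ℕₚ.+-monoˡ-≤ _ (ℕₚ.*-monoʳ-≤ q (q*energy≤ B B!))) ⟩
        4 * (q * (N * (q * Q + N * Q)) + Q * (q * (N * N)))
          ≡⟨ regroup q N Q ⟩
        Q * (8 * N * (q * N)) + N * (4 * (q * (q * Q))) ∎)
        where
        regroup : ∀ q N Q → 4 * (q * (N * (q * Q + N * Q)) + Q * (q * (N * N))) ≡
                            Q * (8 * N * (q * N)) + N * (4 * (q * (q * Q)))
        regroup = ℕ-Ring.solve-∀

      -- `N` is generalised to `n` to split off an empty `B`, where no factor can be cancelled.
      cancel : ∀ n → n * n * M ≤ n * (4 * (q * (q * Q))) → length C * n ≤ 4 * (q * (q * Q))
      cancel zero    _ = ℕₚ.≤-trans (ℕₚ.≤-reflexive (ℕₚ.*-zeroʳ (length C))) z≤n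
      cancel (suc n) h = ℕₚ.≤-trans (ℕₚ.*-monoˡ-≤ (suc n) length-C≤M)
        (ℕₚ.*-cancelˡ-≤ (suc n) (ℕₚ.≤-trans (ℕₚ.≤-reflexive (regroup (suc n) M)) h))
        where
        regroup : ∀ n m → n * (m * n) ≡ n * n * m
        regroup = ℕ-Ring.solve-∀

    -- If |B| is at least q^d/E, the bound of order q^(d+2)/|B| becomes 4Eq², uniform in `B` as
    -- `union-bound` requires.
    few-poor-of-large : ∀ {d} E s (B : List (Point d)) → Unique B → q ^ d ≤ E * length B →
      ∀ C → Unique C → All (λ v → ¬ Rich s B v) C → length C ≤ 4 * E * (q * q)
    few-poor-of-large {d} E s B B! large C C! poor = ℕₚ.*-cancelʳ-≤ _ _ (q ^ d) {{ℕₚ.m^n≢0 q d}} (begin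
      length C * q ^ d                ≤⟨ ℕₚ.*-monoʳ-≤ (length C) large ⟩
      length C * (E * length B)       ≡⟨ regroup (length C) E (length B) ⟩
      E * (length C * length B)       ≤⟨ ℕₚ.*-monoʳ-≤ E (few-poor s B B! C C! poor) ⟩
      E * (4 * (q * (q * q ^ d)))     ≡⟨ regroup′ E q (q ^ d) ⟩
      4 * E * (q * q) * q ^ d         ∎)
      where
      open ℕₚ.≤-Reasoning
      regroup : ∀ x y z → x * (y * z) ≡ y * (x * z)
      regroup = ℕ-Ring.solve-∀
      regroup′ : ∀ x y z → x * (4 * (y * (y * z))) ≡ 4 * x * (y * y) * z
      regroup′ = ℕ-Ring.solve-∀

    -- Greedy choice of the points.

    neighbours : ∀ {d} → Carrier → Point d → List (Point d) → List (Point d)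
    neighbours s v = filter (λ b → dist v b ≟ s)

    -- At least |B|/2q candidates remain: the 2 goes into `D`, the q into the exponent.
    rich⇒large : ∀ {d} D i s (B : List (Point d)) v → Rich s B v → q ^ d ≤ D * q ^ i * length B →
                 q ^ d ≤ 2 * D * q ^ suc i * length (neighbours s v B)
    rich⇒large {d} D i s B v rich large = begin
      q ^ d                                              ≤⟨ large ⟩
      D * q ^ i * length B                               ≤⟨ ℕₚ.*-monoʳ-≤ (D * q ^ i) rich ⟩
      D * q ^ i * (2 * (q * degree s v B))               ≡⟨ regroup D (q ^ i) q (degree s v B) ⟩
      2 * D * (q * q ^ i) * degree s v B                 ≡⟨ cong (2 * D * (q * q ^ i) *_) (length-filter-∑ _ B) ⟨
      2 * D * q ^ suc i * length (neighbours s v B)      ∎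
      where
      open ℕₚ.≤-Reasoning
      regroup : ∀ D x q y → D * x * (2 * (q * y)) ≡ 2 * D * (q * x) * y
      regroup = ℕ-Ring.solve-∀

    -- Put E = D q^i. Each of `m` later sets spoils at most 4Eq² choices, and 2E times the total is
    -- 8mD² q^(2i+2). The threshold bounds 8mD² by q, and q^(2i+3) fits into q^d by the condition on
    -- the dimension.
    losses-small : ∀ {d} m i D → threshold m D ≤ q → 2 * i + 3 ≤ d →
                   2 * (D * q ^ i * (m * (4 * (D * q ^ i) * (q * q)))) ≤ q ^ d
    losses-small {d} m i D q-large d-large = begin
      2 * (D * q ^ i * (m * (4 * (D * q ^ i) * (q * q))))  ≡⟨ regroup D (q ^ i) m q ⟩
      m * (8 * (D * D)) * (q ^ i * (q ^ i * (q * q)))      ≤⟨ ℕₚ.*-monoˡ-≤ _ (ℕₚ.≤-trans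
                                                                (ℕₚ.m≤m*n (m * (8 * (D * D))) (4 ^ m) {{ℕₚ.m^n≢0 4 m}}) q-large) ⟩
      q * (q ^ i * (q ^ i * (q * q)))                      ≡⟨ regroup′ q (q ^ i) ⟩
      q ^ i * q ^ i * (q * (q * (q * 1)))                  ≡⟨ cong (_* q ^ 3) (ℕₚ.^-distribˡ-+-* q i i) ⟨
      q ^ (i + i) * q ^ 3                                  ≡⟨ ℕₚ.^-distribˡ-+-* q (i + i) 3 ⟨
      q ^ (i + i + 3)                                      ≤⟨ ℕₚ.^-monoʳ-≤ q (ℕₚ.≤-trans
                                                                (ℕₚ.≤-reflexive (double i)) d-large) ⟩
      q ^ d                                                ∎
      where
      open ℕₚ.≤-Reasoning
      regroup : ∀ D x m q → 2 * (D * x * (m * (4 * (D * x) * (q * q)))) ≡ m * (8 * (D * D)) * (x * (x * (q * q)))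
      regroup = ℕ-Ring.solve-∀
      regroup′ : ∀ q x → q * (x * (x * (q * q))) ≡ x * x * (q * (q * (q * 1)))
      regroup′ = ℕ-Ring.solve-∀
      double : ∀ i → i + i + 3 ≡ 2 * i + 3
      double = ℕ-Ring.solve-∀

    -- Discard from `B zero` the points that are poor for some later set. Of the 2q^d guaranteed for
    -- `2 * (E * length (B zero))` the discarded points account for at most q^d.
    rich-choices : ∀ {d} m i D (s : Fin m → Carrier) (B : Fin (suc m) → List (Point d)) →
      (∀ j → Unique (B j)) → (∀ j → q ^ d ≤ D * q ^ i * length (B j)) →
      threshold m D ≤ q → 2 * i + 3 ≤ d →
      ∃ λ G → Unique G × G ⊆ B zero × (∀ j → All (Rich (s j) (B (suc j))) G) ×
        q ^ d ≤ 2 * (D * q ^ i) * length G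
    rich-choices {d} m i D s B B! large q-large d-large =
      let G , G! , G⊆B₀ , rich , |B₀|≤ =
            union-bound m (λ j → rich? (s j) (B (suc j)))
              (λ j → few-poor-of-large E (s j) (B (suc j)) (B! (suc j)) (large (suc j)))
              (B zero) (B! zero)
      in G , G! , G⊆B₀ , rich , G-large (length G) |B₀|≤
      where
      E = D * q ^ i
      G-large : ∀ g → length (B zero) ≤ g + m * (4 * E * (q * q)) → q ^ d ≤ 2 * E * g
      G-large g |B₀|≤ = ℕₚ.+-cancelʳ-≤ (q ^ d) _ _ (begin
        q ^ d + q ^ d                                    ≡⟨ cong (q ^ d +_) (ℕₚ.+-identityʳ (q ^ d)) ⟨
        2 * q ^ d                                        ≤⟨ ℕₚ.*-monoʳ-≤ 2 (large zero) ⟩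
        2 * (E * length (B zero))                        ≤⟨ ℕₚ.*-monoʳ-≤ 2 (ℕₚ.*-monoʳ-≤ E |B₀|≤) ⟩
        2 * (E * (g + m * (4 * E * (q * q))))            ≡⟨ regroup E g (m * (4 * E * (q * q))) ⟩
        2 * E * g + 2 * (E * (m * (4 * E * (q * q))))    ≤⟨ ℕₚ.+-monoʳ-≤ (2 * E * g)
                                                              (losses-small m i D q-large d-large) ⟩
        2 * E * g + q ^ d                                ∎)
        where
        open ℕₚ.≤-Reasoning
        regroup : ∀ e g t → 2 * (e * (g + t)) ≡ 2 * e * g + 2 * (e * t)
        regroup = ℕ-Ring.solve-∀

    -- The choices of the next point multiply the number of continuations; `loss` and `codim` are
    -- defined so as to collect the factors 2D and q^i.
    count-step : ∀ {d} m i D g n → q ^ d ≤ 2 * (D * q ^ i) * g →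
      g * q ^ (m * d) ≤ n * (loss m (2 * D) * q ^ codim m (suc i)) →
      q ^ (suc m * d) ≤ n * (loss (suc m) D * q ^ codim (suc m) i)
    count-step {d} m i D g n g-large n-large = begin
      q ^ (d + m * d)                                    ≡⟨ ℕₚ.^-distribˡ-+-* q d (m * d) ⟩
      q ^ d * q ^ (m * d)                                ≤⟨ ℕₚ.*-monoˡ-≤ (q ^ (m * d)) g-large ⟩
      2 * (D * q ^ i) * g * q ^ (m * d)                  ≡⟨ ℕₚ.*-assoc (2 * (D * q ^ i)) g (q ^ (m * d)) ⟩
      2 * (D * q ^ i) * (g * q ^ (m * d))                ≤⟨ ℕₚ.*-monoʳ-≤ (2 * (D * q ^ i)) n-large ⟩
      2 * (D * q ^ i) * (n * (loss m (2 * D) * q ^ codim m (suc i)))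
        ≡⟨ regroup D (q ^ i) n (loss m (2 * D)) (q ^ codim m (suc i)) ⟩
      n * (loss (suc m) D * (q ^ i * q ^ codim m (suc i)))
        ≡⟨ cong (λ x → n * (loss (suc m) D * x)) (ℕₚ.^-distribˡ-+-* q i (codim m (suc i))) ⟨
      n * (loss (suc m) D * q ^ codim (suc m) i) ∎
      where
      open ℕₚ.≤-Reasoning
      regroup : ∀ D x y l z → 2 * (D * x) * (y * (l * z)) ≡ y * (2 * D * l * (x * z))
      regroup = ℕ-Ring.solve-∀

    -- Choose the points in order, keeping for each later index j the candidates B j at the
    -- prescribed distances from the points chosen so far; each choice costs a factor q.
    embed : ∀ {d} m i D (ℓ : Fin (suc m) → Fin (suc m) → Carrier) (B : Fin (suc m) → List (Point d)) →
      (∀ j → Unique (B j)) → (∀ j → q ^ d ≤ D * q ^ i * length (B j)) →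
      threshold m D ≤ q → 2 * (i + m) + 3 ≤ d →
      Family (λ y → (∀ j → y j ∈ B j) × (∀ {i j} → i Fin.< j → dist (y i) (y j) ≡ ℓ i j))
             (q ^ (m * d)) (loss m D * q ^ codim m i)
    embed {d} zero i D ℓ B B! large _ _ =
      -- The last point only needs a nonempty candidate set, and an empty one would force q^d ≤ 0.
      -- One tuple suffices since `loss zero D` is 1 and `codim zero i` is 0.
      let v , v∈ = inhabitant (B zero) λ B₀≡[] → ℕₚ.<⇒≱ (ℕₚ.m^n>0 q d) (ℕₚ.≤-trans (large zero)
            (ℕₚ.≤-reflexive (trans (cong (λ xs → D * q ^ i * length xs) B₀≡[]) (ℕₚ.*-zeroʳ (D * q ^ i)))))
      in (λ _ → v) ∷ [] , ℕₚ.≤-refl , ((λ { zero → v∈ }) , λ { {zero} {zero} () }) ∷ [] , [] ∷ []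
    embed {d} (suc m) i D ℓ B B! large q-large d-large =
      let G , G! , G⊆B₀ , rich , G-large =
            rich-choices (suc m) i D (λ j → ℓ zero (suc j)) B B! large q-large
              (ℕₚ.≤-trans (ℕₚ.+-monoˡ-≤ 3 (ℕₚ.*-monoʳ-≤ 2 (ℕₚ.m≤m+n i (suc m)))) d-large)
          Ys , bound , Ys-good , Ys! = extend-family G G! (λ {v} v∈G →
            embed m (suc i) (2 * D) (λ j j′ → ℓ (suc j) (suc j′))
              (λ j → neighbours (ℓ zero (suc j)) v (B (suc j)))
              (λ j → Uniqueₚ.filter⁺ _ (B! (suc j)))
              (λ j → rich⇒large D i _ (B (suc j)) v (All.lookup (rich j) v∈G) (large (suc j)))
              (ℕₚ.≤-trans (threshold-step m D) q-large)
              -- Passing from `i` and `suc m` to `suc i` and `m` keeps the sum, so the condition on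
              -- `d` is inherited.
              (ℕₚ.≤-trans (ℕₚ.≤-reflexive (cong (λ x → 2 * x + 3) (sym (ℕₚ.+-suc i m)))) d-large))
      in Ys , count-step m i D (length G) (length Ys) G-large bound ,
         All.map (λ (y₀∈G , good) → assemble (G⊆B₀ y₀∈G) good) Ys-good , Ys!
      where
      assemble : ∀ {y : Fin (suc (suc m)) → Point d} → y zero ∈ B zero →
        (∀ j → y (suc j) ∈ neighbours (ℓ zero (suc j)) (y zero) (B (suc j))) ×
          (∀ {i j} → i Fin.< j → dist (y (suc i)) (y (suc j)) ≡ ℓ (suc i) (suc j)) →
        (∀ j → y j ∈ B j) × (∀ {i j} → i Fin.< j → dist (y i) (y j) ≡ ℓ i j)
      assemble {y} y₀∈B₀ (y∈ , dists) =
        (λ { zero → y₀∈B₀ ; (suc j) → proj₁ (∈-filter⁻ _ {xs = B (suc j)} (y∈ j)) }) ,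
        λ { {zero} {suc j} _ → proj₂ (∈-filter⁻ _ {xs = B (suc j)} (y∈ j)) ; {suc i} {suc j} (s≤s i<j) → dists i<j }

    -- Counting copies in a dense set.

    -- The number of points enters through an equation, so that matching on `refl` turns the k + 2
    -- of the theorem into successor form.
    isometricCopies : ∀ k D d → d ≥ 2 * k + 6 →
      suc (suc (suc k) * D) ≤ q → threshold (suc k) (2 * (suc (suc k) * D)) ≤ q →
      ∀ (A : List (Point d)) → Unique A → q ^ d ≤ D * length A →
      ∀ {n} → n ≡ suc (suc k) → (X : Fin n → Point d) →
      ∃ λ N → q ^ exponent k d ≤ N * loss (suc k) (2 * (suc (suc k) * D)) × AtLeastCopies N A X
    isometricCopies k D d d≥ nD<q q-large A A! A-large refl X =
      let B , B! , s≤B , B⊆A , disjoint = split-disjoint n s A A! (ℕₚ.≤-trans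
            (ℕₚ.≤-reflexive (ℕₚ.*-comm n s)) (m/n*n≤m (length A) n))
          Ys , Ys-large , Ys-good , Ys! = embed (suc k) 0 D₀ (λ i j → dist (X i) (X j)) B B!
            (λ j → ℕₚ.≤-trans s-large (ℕₚ.*-monoʳ-≤ (D₀ * q ^ 0) (s≤B j))) q-large d-large
          good : ∀ t → (∀ j → lookup Ys t j ∈ B j) ×
                       (∀ {i j} → i Fin.< j → dist (lookup Ys t i) (lookup Ys t j) ≡ dist (X i) (X j))
          good t = All.lookup Ys-good (∈-lookup t)
      in length Ys , count (length Ys) Ys-large , lookup Ys
       , (λ t → (λ {i} {j} yi≡yj → disjoint i j (proj₁ (good t) i)
                    (subst (_∈ B j) (sym yi≡yj) (proj₁ (good t) j)))
              , (λ i → B⊆A i (proj₁ (good t) i))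
              , isometric (lookup Ys t) (proj₂ (good t)))
       , λ t t′ t≢t′ → differentSets B disjoint (lookup Ys t) (lookup Ys t′) (proj₁ (good t)) (proj₁ (good t′))
           (AllPairs-lookup (λ (j , ≢) → j , ≢ ∘ sym) Ys! t t′ t≢t′)
      where
      n = suc (suc k)
      s = length A / n
      -- The `n` comes from cutting `A` into `n` blocks, the 2 from rounding their size down.
      D₀ = 2 * (n * D)
      w = codim (suc k) 0

      q≤q^d : q ≤ q ^ d
      q≤q^d = ℕₚ.≤-trans (ℕₚ.≤-reflexive (sym (ℕₚ.*-identityʳ q)))
        (ℕₚ.^-monoʳ-≤ q {1} (ℕₚ.≤-trans (s≤s z≤n) (ℕₚ.≤-trans (ℕₚ.m≤n+m 6 (2 * k)) d≥)))

      s-large : q ^ d ≤ D₀ * q ^ 0 * s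
      s-large = bound s (begin
        q ^ d                                ≤⟨ A-large ⟩
        D * length A                         ≡⟨ cong (D *_) (m≡m%n+[m/n]*n (length A) n) ⟩
        D * (length A % n + s * n)           ≤⟨ ℕₚ.*-monoʳ-≤ D (ℕₚ.+-monoˡ-≤ (s * n) (ℕₚ.<⇒≤ (m%n<n (length A) n))) ⟩
        D * (n + s * n)                      ∎)
        where
        open ℕₚ.≤-Reasoning
        -- Block size zero would force q ≤ q^d ≤ nD, against the lower bound on q; for positive s, n
        -- + sn is at most 2sn.
        bound : ∀ s → q ^ d ≤ D * (n + s * n) → q ^ d ≤ D₀ * q ^ 0 * s
        bound zero    h = contradiction (ℕₚ.≤-trans q≤q^d (ℕₚ.≤-trans h (ℕₚ.≤-reflexive (regroup D n))))
                            (ℕₚ.<⇒≱ nD<q)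
          where
          regroup : ∀ D n → D * (n + 0) ≡ n * D
          regroup = ℕ-Ring.solve-∀
        bound (suc s) h = ℕₚ.≤-trans h (ℕₚ.m+n≤o⇒m≤o _ (ℕₚ.≤-reflexive (regroup D n s)))
          where
          regroup : ∀ D n s → D * (n + suc s * n) + D * (s * n) ≡ 2 * (n * D) * 1 * suc s
          regroup = ℕ-Ring.solve-∀

      d-large : 2 * suc k + 3 ≤ d
      d-large = ℕₚ.≤-trans (ℕₚ.m+n≤o⇒m≤o _ (ℕₚ.≤-reflexive (regroup k))) d≥
        where
        regroup : ∀ k → 2 * suc k + 3 + 1 ≡ 2 * k + 6
        regroup = ℕ-Ring.solve-∀

      -- `w` is 0 + 1 + ... + k, so its double is k(k+1) and the division is exact.
      w-closed : k * suc k / 2 ≡ w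
      w-closed = trans (cong (_/ 2) (trans (ℕₚ.*-comm k (suc k)) (sym (codim-closed k 0)))) (m*n/n≡m w 2)

      -- Makes the truncated subtraction in `exponent` a true one.
      w≤ : w ≤ suc k * d
      w≤ = begin
        w                ≡⟨ w-closed ⟨
        k * suc k / 2    ≤⟨ m/n≤m (k * suc k) 2 ⟩
        k * suc k        ≡⟨ ℕₚ.*-comm k (suc k) ⟩
        suc k * k        ≤⟨ ℕₚ.*-monoʳ-≤ (suc k) (ℕₚ.≤-trans (ℕₚ.≤-trans (ℕₚ.m≤n*m k 2) (ℕₚ.m≤m+n (2 * k) 6)) d≥) ⟩
        suc k * d        ∎
        where open ℕₚ.≤-Reasoning

      count : ∀ N → q ^ (suc k * d) ≤ N * (loss (suc k) D₀ * q ^ w) → q ^ exponent k d ≤ N * loss (suc k) D₀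
      count N h = ℕₚ.*-cancelʳ-≤ _ _ (q ^ w) {{ℕₚ.m^n≢0 q w}} (begin
        q ^ exponent k d * q ^ w             ≡⟨ cong (λ x → q ^ (suc k * d ∸ x) * q ^ w) w-closed ⟩
        q ^ (suc k * d ∸ w) * q ^ w          ≡⟨ ℕₚ.^-distribˡ-+-* q (suc k * d ∸ w) w ⟨
        q ^ (suc k * d ∸ w + w)              ≡⟨ cong (q ^_) (ℕₚ.m∸n+n≡m w≤) ⟩
        q ^ (suc k * d)                      ≤⟨ h ⟩
        N * (loss (suc k) D₀ * q ^ w)        ≡⟨ ℕₚ.*-assoc N (loss (suc k) D₀) (q ^ w) ⟨
        N * loss (suc k) D₀ * q ^ w          ∎)
        where open ℕₚ.≤-Reasoning

      isometric : ∀ (y : Fin n → Point d) → (∀ {i j} → i Fin.< j → dist (y i) (y j) ≡ dist (X i) (X j)) →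
                  ∀ i j → dist (y i) (y j) ≡ dist (X i) (X j)
      isometric y ordered i j with Finₚ.<-cmp i j
      ... | tri< i<j _ _    = ordered i<j
      ... | tri≈ _ refl _   = trans (dist-refl (y i)) (sym (dist-refl (X i)))
      ... | tri> _ _ j<i    = trans (dist-sym (y i) (y j)) (trans (ordered j<i) (dist-sym (X j) (X i)))

      -- A common point y_i = z_j lies in `B i` and `B j`, so i = j. At an index where the tuples
      -- disagree, y_i is therefore not among the points of `z`.
      differentSets : ∀ (B : Fin n → List (Point d)) → (∀ i j {x} → x ∈ B i → x ∈ B j → i ≡ j) →
        ∀ y z → (∀ j → y j ∈ B j) → (∀ j → z j ∈ B j) → Distinct y z → DifferentSets y z
      differentSets B disjoint y z y∈ z∈ (i , yi≢zi) = i , λ j yi≡zj →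
        yi≢zi (trans yi≡zj (cong z (sym (disjoint i j (y∈ i) (subst (_∈ B j) (sym yi≡zj) (z∈ j))))))

-- Passing between rational and natural inequalities.

toℚᵘ-ℕ→ℚ : ∀ n → ℚ.toℚᵘ (ℕ→ℚ n) ℚᵘ.≃ ℚᵘ.mkℚᵘ (ℤ.+ n) 0
toℚᵘ-ℕ→ℚ n = ℚₚ.toℚᵘ-fromℚᵘ (ℚᵘ.mkℚᵘ (ℤ.+ n) 0)

toℚᵘ-*-ℕ→ℚ : ∀ p n → ℚ.toℚᵘ (p ℚ.* ℕ→ℚ n) ℚᵘ.≃ ℚ.toℚᵘ p ℚᵘ.* ℚᵘ.mkℚᵘ (ℤ.+ n) 0
toℚᵘ-*-ℕ→ℚ p n = ℚᵘₚ.≃-trans (ℚₚ.toℚᵘ-homo-* p (ℕ→ℚ n)) (ℚᵘₚ.*-congˡ {ℚ.toℚᵘ p} (toℚᵘ-ℕ→ℚ n))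

-- A positive α has numerator at least 1, so it is at least the reciprocal of its denominator; that
-- reciprocal serves as the density.
density⇒≤ : ∀ α → ℚ.0ℚ ℚ.< α → ∀ {m n} → α ℚ.* ℕ→ℚ m ℚ.≤ ℕ→ℚ n → m ≤ ℚ.↧ₙ α * n
density⇒≤ (mkℚ (ℤ.+ zero) _ _)    (ℚ.*<* (ℤ.+<+ ())) _
density⇒≤ (mkℚ ℤ.-[1+ _ ] _ _)    (ℚ.*<* ())         _
density⇒≤ α@(mkℚ (ℤ.+ suc p) e _) _ {m} {n} αm≤n
  with ℚᵘ.*≤* h ← ℚᵘₚ.≤-respˡ-≃ (toℚᵘ-*-ℕ→ℚ α m) (ℚᵘₚ.≤-respʳ-≃ (toℚᵘ-ℕ→ℚ n) (ℚₚ.toℚᵘ-mono-≤ αm≤n)) =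
  ℕₚ.≤-trans (ℕₚ.m≤n*m m (suc p)) (ℤₚ.drop‿+≤+ (begin
    ℤ.+ (suc p * m)                             ≡⟨ trans (ℤₚ.*-identityʳ _) (sym (ℤₚ.pos-* (suc p) m)) ⟨
    (ℤ.+ suc p ℤ.* ℤ.+ m) ℤ.* ℤ.+ 1             ≤⟨ h ⟩
    ℤ.+ n ℤ.* ℤ.+ (suc e * 1)                   ≡⟨ ℤₚ.pos-* n (suc e * 1) ⟨
    ℤ.+ (n * (suc e * 1))                       ≡⟨ cong ℤ.+_ (trans (cong (n *_) (ℕₚ.*-identityʳ (suc e))) (ℕₚ.*-comm n (suc e))) ⟩
    ℤ.+ (suc e * n)                             ∎))
  where open ℤₚ.≤-Reasoning

-- In unnormalised rationals no gcd intervenes and the claim is cross-multiplication.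
≤⇒reciprocal-≤ : ∀ K {m n} → m ≤ n * suc K → (ℤ.+ 1 ℚ./ suc K) ℚ.* ℕ→ℚ m ℚ.≤ ℕ→ℚ n
≤⇒reciprocal-≤ K {m} {n} m≤ = ℚₚ.toℚᵘ-cancel-≤ (ℚᵘₚ.≤-respˡ-≃
  (ℚᵘₚ.≃-sym (ℚᵘₚ.≃-trans (toℚᵘ-*-ℕ→ℚ (ℤ.+ 1 ℚ./ suc K) m)
    (ℚᵘₚ.*-congʳ {ℚᵘ.mkℚᵘ (ℤ.+ m) 0} (ℚₚ.toℚᵘ-fromℚᵘ (ℚᵘ.mkℚᵘ (ℤ.+ 1) K)))))
  (ℚᵘₚ.≤-respʳ-≃ (ℚᵘₚ.≃-sym (toℚᵘ-ℕ→ℚ n)) (ℚᵘ.*≤* (begin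
    (ℤ.+ 1 ℤ.* ℤ.+ m) ℤ.* ℤ.+ 1       ≡⟨ trans (ℤₚ.*-identityʳ _) (ℤₚ.*-identityˡ _) ⟩
    ℤ.+ m                             ≤⟨ ℤ.+≤+ m≤ ⟩
    ℤ.+ (n * suc K)                   ≡⟨ cong (λ x → ℤ.+ (n * x)) (ℕₚ.*-identityʳ (suc K)) ⟨
    ℤ.+ (n * (suc K * 1))             ≡⟨ ℤₚ.pos-* n (suc K * 1) ⟩
    ℤ.+ n ℤ.* ℤ.+ (suc K * 1)         ∎))))
  where open ℤₚ.≤-Reasoning

theorem2p1 : ∀ (k : ℕ) (α : ℚ) → ℚ.0ℚ ℚ.< α → α ℚ.< ℚ.1ℚ →
    Σ ℕ λ q₀ → Σ ℚ λ c → (ℚ.0ℚ ℚ.< c) ×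
    (∀ (d : ℕ) → d ≥ 2 ℕ.* k ℕ.+ 6 →
    ∀ (F : FiniteField) → FiniteField.OddCharacteristic F → FiniteField.size F ≥ q₀ →
    ∀ (A : List (FiniteField.Point F d)) → Unique A →
    α ℚ.* ℕ→ℚ (FiniteField.size F ℕ.^ d) ℚ.≤ ℕ→ℚ (length A) →
    ∀ (X : Fin (k ℕ.+ 2) → FiniteField.Point F d) → Injective _≡_ _≡_ X →
    FiniteField.Spherical F X → FiniteField.SpansDim F X k →
    ∃ λ (N : ℕ) → (c ℚ.* ℕ→ℚ (FiniteField.size F ℕ.^ exponent k d) ℚ.≤ ℕ→ℚ N)
    × FiniteField.AtLeastCopies F N A X)
theorem2p1 k α 0<α _ =
  -- `q₀` adds the two lower bounds required of q, so that each follows from q ≥ q₀. The denominator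
  -- of `c` is `suc K`, nonzero by its form.
  suc (n * D) + threshold (suc k) (2 * (n * D)) , ℤ.+ 1 ℚ./ suc K ,
  ℚₚ.positive⁻¹ _ {{ℚₚ.normalize-pos 1 (suc K)}} ,
  λ d d≥ F odd q≥q₀ A A! A-dense X _ _ _ →
    let N , count , copies = FieldGeometry.isometricCopies F odd k D d d≥
          (ℕₚ.m+n≤o⇒m≤o _ q≥q₀) (ℕₚ.m+n≤o⇒n≤o (suc (n * D)) q≥q₀) A A!
          (density⇒≤ α 0<α A-dense) (ℕₚ.+-comm k 2) X
    in N , ≤⇒reciprocal-≤ K {n = N} (ℕₚ.≤-trans count (ℕₚ.*-monoʳ-≤ N (ℕₚ.n≤1+n K))) , copies
  where
  n = suc (suc k)
  D = ℚ.↧ₙ α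
  K = loss (suc k) (2 * (n * D))
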